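{- Let $n\ge 3$ and let $\{S_i\}_{i=1}^n$ be a family of bounded semilattices, each with $0_{S_i}\neq 1_{S_i}$. Suppose each $S_i$ is a finite chain and let $S=\prod_{i=1}^n S_i$. Then $G(S)$ is Eulerian if and only if either (a) the length $l(S_i)$ is even for all $1\le i\le n$, or (b) each $S_i$ has exactly two elements.
   Context: A bounded semilattice $(S,\cdot,0,1)$ is a commutative semigroup whose operation is idempotent ($x\cdot x=x$ for all $x$), with a neutral element $1$ and an absorbing element $0$; it is partially ordered by $x\le y \iff x\cdot y=x$, so that $0\le x\le 1$. It is a chain if this order is total. The graph $G(S)$ is the simple graph with vertex set $S\setminus\{0,1\}$ in which two vertices $x,y$ are adjacent iff $x\ne y$ and $x\cdot y\neq 0$. The product $\prod_i S_i$ is a bounded semilattice with componentwise operation, $0_S=(0_{S_i})$ and $1_S=(1_{S_i})$. The length of a poset $P$ is $l(P)=\sup\{|C|-1 : C \text{ a chain of } P\}$; in particular a finite chain with $k$ elements has length $k-1$. A graph is Eulerian if it is connected and admits a closed walk traversing each edge exactly once. -}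

module Defs where

open import Algebra.Core using (Op₂)
open import Algebra.Definitions using (Zero)
open import Algebra.Lattice.Structures using (IsBoundedSemilattice)
open import Data.Fin.Base using (Fin)
open import Data.List.Base using (List; []; _∷_; length; lookup)
open import Data.Nat.Base as ℕ using (ℕ)
open import Data.Nat.Divisibility using (_∣_)
open import Data.Product using (Σ; ∃; ∃!; _×_; _,_; proj₁; proj₂)
open import Data.Sum.Base using (_⊎_)
open import Function.Base using (_on_)
open import Function.Bundles using (Injection; Inverse)
open import Level using (Level; suc; _⊔_)
open import Relation.Binary.Bundles using (Setoid; Poset)
open import Relation.Binary.Core using (Rel)
open import Relation.Binary.Definitions using (Symmetric; Total; _Respects₂_)
import Relation.Binary.Construct.NaturalOrder.Left as NaturalOrder
import Relation.Binary.Construct.On as On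
open import Relation.Binary.PropositionalEquality as ≡ using (_≡_)
open import Relation.Nullary.Negation using (¬_)

private
  variable
    c ℓ ℓ₁ ℓ₂ : Level

-- Sets are setoids throughout, so that a product of a family (functions under
-- pointwise equality) needs no function extensionality.

HasSize : Setoid c ℓ → ℕ → Set (c ⊔ ℓ)
HasSize A k = Inverse (≡.setoid (Fin k)) A

IsFinite : Setoid c ℓ → Set (c ⊔ ℓ)
IsFinite A = ∃ λ k → HasSize A k

-- Unlike the library's bundle of the same name, this one also has an
-- absorbing element.

record BoundedSemilattice c ℓ : Set (suc (c ⊔ ℓ)) where
  infixr 7 _·_
  infix  4 _≈_
  field
    Carrier              : Set c
    _≈_                  : Rel Carrier ℓ
    _·_                  : Op₂ Carrier
    0#                   : Carrier
    1#                   : Carrier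
    isBoundedSemilattice : IsBoundedSemilattice _≈_ _·_ 1#
    zero                 : Zero _≈_ 0# _·_

  open IsBoundedSemilattice _≈_ isBoundedSemilattice public

  -- x ≤ y is x ≈ x · y
  poset : Poset c ℓ ℓ
  poset = NaturalOrder.poset _≈_ _·_ isSemilattice

  open Poset poset public using (_≤_)

IsChain : BoundedSemilattice c ℓ → Set (c ⊔ ℓ)
IsChain S = Total (BoundedSemilattice._≤_ S)

∏ : ∀ {n} → (Fin n → BoundedSemilattice c ℓ) → BoundedSemilattice c ℓ
∏ S = record
  { Carrier = ∀ i → S.Carrier i
  ; _≈_     = λ x y → ∀ i → S._≈_ i (x i) (y i)
  ; _·_     = λ x y i → S._·_ i (x i) (y i)
  ; 0#      = λ i → S.0# i
  ; 1#      = λ i → S.1# i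
  ; isBoundedSemilattice = record
    { isCommutativeMonoid = record
      { isMonoid = record
        { isSemigroup = record
          { isMagma = record
            { isEquivalence = record
              { refl  = λ i → S.refl i
              ; sym   = λ p i → S.sym i (p i)
              ; trans = λ p q i → S.trans i (p i) (q i)
              }
            ; ∙-cong = λ p q i → S.∙-cong i (p i) (q i)
            }
          ; assoc = λ x y z i → S.assoc i (x i) (y i) (z i)
          }
        ; identity = (λ x i → S.identityˡ i (x i)) , (λ x i → S.identityʳ i (x i))
        }
      ; comm = λ x y i → S.comm i (x i) (y i)
      }
    ; idem = λ x i → S.idem i (x i)
    }
  ; zero = (λ x i → proj₁ (S.zero i) (x i)) , (λ x i → proj₂ (S.zero i) (x i))
  }
  where module S i = BoundedSemilattice (S i)

-- A chain of P with k elements, listed without repetition in any order.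

record FiniteChain (P : Poset c ℓ₁ ℓ₂) (k : ℕ) : Set (c ⊔ ℓ₁ ⊔ ℓ₂) where
  open Poset P
  field
    elements : Injection (≡.setoid (Fin k)) Eq.setoid

  open Injection elements using (to)

  field
    comparable : ∀ i j → to i ≤ to j ⊎ to j ≤ to i

-- l is the least upper bound of |C| - 1 over the nonempty finite chains C of P.
-- Infinite chains need no mention: they contain finite chains of every size,
-- so a poset with an infinite chain has no length in ℕ.

IsLength : Poset c ℓ₁ ℓ₂ → ℕ → Set (c ⊔ ℓ₁ ⊔ ℓ₂)
IsLength P l = IsUpperBound l × (∀ m → IsUpperBound m → l ℕ.≤ m)
  where
  IsUpperBound : ℕ → Set _
  IsUpperBound m = ∀ k → FiniteChain P (ℕ.suc k) → k ℕ.≤ m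

HasEvenLength : Poset c ℓ₁ ℓ₂ → Set (c ⊔ ℓ₁ ⊔ ℓ₂)
HasEvenLength P = ∃ λ l → IsLength P l × 2 ∣ l

record SimpleGraph c ℓ₁ ℓ₂ : Set (suc (c ⊔ ℓ₁ ⊔ ℓ₂)) where
  infix 4 _~_
  field
    vertices : Setoid c ℓ₁

  open Setoid vertices public using (_≈_) renaming (Carrier to Vertex)

  field
    _~_    : Rel Vertex ℓ₂
    ~-resp : _~_ Respects₂ _≈_
    ~-sym  : Symmetric _~_
    ~-irr  : ∀ {x y} → x ≈ y → ¬ (x ~ y)

  data Walk : Vertex → Vertex → Set (c ⊔ ℓ₁ ⊔ ℓ₂) where
    nil  : ∀ {x y} → x ≈ y → Walk x y
    cons : ∀ {x y z} → x ~ y → Walk y z → Walk x z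

  steps : ∀ {x y} → Walk x y → List (Vertex × Vertex)
  steps (nil _)              = []
  steps (cons {x} {y} _ w) = (x , y) ∷ steps w

  -- Equality of the unordered pairs of endpoints.
  SameEdge : Rel (Vertex × Vertex) ℓ₁
  SameEdge (a , b) (x , y) = (a ≈ x × b ≈ y) ⊎ (a ≈ y × b ≈ x)

  TraversesEachEdgeOnce : ∀ {x y} → Walk x y → Set (c ⊔ ℓ₁ ⊔ ℓ₂)
  TraversesEachEdgeOnce w =
    ∀ a b → a ~ b →
    ∃! _≡_ λ (i : Fin (length (steps w))) → SameEdge (lookup (steps w) i) (a , b)

  Connected : Set (c ⊔ ℓ₁ ⊔ ℓ₂)
  Connected = ∀ x y → Walk x y

  Eulerian : Set (c ⊔ ℓ₁ ⊔ ℓ₂)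
  Eulerian = Connected × ∃ λ x → Σ (Walk x x) TraversesEachEdgeOnce

G : BoundedSemilattice c ℓ → SimpleGraph (c ⊔ ℓ) ℓ ℓ
G S = record
  { vertices = record
    { Carrier       = Σ Carrier λ x → ¬ (x ≈ 0#) × ¬ (x ≈ 1#)
    ; _≈_           = _≈_ on proj₁
    ; isEquivalence = On.isEquivalence proj₁ isEquivalence
    }
  ; _~_    = λ (x , _) (y , _) → ¬ (x ≈ y) × ¬ (x · y ≈ 0#)
  ; ~-resp = (λ y≈z (x≉y , xy≉0) →
                (λ x≈z → x≉y (trans x≈z (sym y≈z))) ,
                (λ xz≈0 → xy≉0 (trans (∙-cong refl y≈z) xz≈0)))
           , (λ x≈z (x≉y , xy≉0) →
                (λ z≈y → x≉y (trans x≈z z≈y)) ,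
                (λ zy≈0 → xy≉0 (trans (∙-cong x≈z refl) zy≈0)))
  ; ~-sym  = λ (x≉y , xy≉0) →
               (λ y≈x → x≉y (sym y≈x)) ,
               (λ yx≈0 → xy≉0 (trans (comm _ _) yx≈0))
  ; ~-irr  = λ x≈y (x≉y , _) → x≉y x≈y
  }
  where open BoundedSemilattice S

{-# OPTIONS --safe #-}
-- In a product of chains x · y is nonzero iff the supports of x and y meet, so
-- a vertex x has degree |S| − 2 − z(x), where z(x) = #(y : x · y = 0) is the
-- product of the sizes of the S i with x i = 0. If all sizes are odd, so are |S|
-- and every z(x); if all are 2, both are even. Conversely, if |S| is even but some
-- S i has a third element, that element completed by 1s is a vertex with z = 1.
-- Any two vertices are joined through a vertex with at most two nonzero
-- coordinates, hence G(S) is connected and Euler's theorem applies: an open trail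
-- extends at its end, where it uses an odd number of edges, and a closed trail
-- missing an edge can be rotated so as to end at a vertex with an unused edge.
module Submission where

open import Defs
open import Data.Bool.Base using (if_then_else_)
open import Data.Fin.Base using (Fin; zero; suc; fromℕ<)
import Data.Fin.Properties as Fin
open import Data.List.Base using (List; []; _∷_; lookup; map; cartesianProductWith; tabulate)
open import Data.List.Properties using (map-cong; map-∘; map-++; map-tabulate; tabulate-cong)
open import Data.List.Relation.Unary.Any as Any using (Any; here; there; any?)
open import Data.Nat.Base using (ℕ; zero; suc; _+_; _*_; _≤_; _<_; z≤n; s≤s; s≤s⁻¹)
open import Data.Nat.Divisibility using
  (_∣_; _∤_; _∣?_; divides; _∣0; ∣-refl; ∣1⇒≡1; ∣m∣n⇒∣m+n; ∣m+n∣m⇒∣n; ∣m⇒∣m*n; ∣n⇒∣m*n)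
open import Data.Nat.ListAction using (sum; product)
open import Data.Nat.ListAction.Properties using (sum-++)
open import Data.Nat.Primality using (euclidsLemma; prime[2])
open import Data.Nat.Properties as ℕ using
  (+-identityʳ; +-mono-≤; *-distribˡ-+; *-identityʳ; *-zeroʳ; *-comm)
open import Data.Nat.Tactic.RingSolver using (solve-∀)
open import Data.Product using (Σ; ∃; ∃!; _×_; _,_; proj₁; proj₂)
open import Data.Sum.Base as Sum using (_⊎_; inj₁; inj₂; [_,_]′)
open import Function.Base using (_∘_; id)
open import Function.Bundles using (_⇔_; mk⇔; Equivalence; Inverse; Injection)
open import Level using (Level; _⊔_)
open import Relation.Binary.Bundles using (Setoid)
import Relation.Binary.Construct.On as On
open import Relation.Binary.Definitions using (Decidable; _Respects_)
open import Relation.Binary.PropositionalEquality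
  using (_≡_; _≢_; refl; sym; trans; cong; cong₂; subst; module ≡-Reasoning)
open import Relation.Nullary.Decidable using
  (Dec; yes; no; does; map′; ¬?; _×-dec_; _⊎-dec_; decidable-stable)
open import Relation.Nullary.Negation using (¬_; contradiction)
import Relation.Unary as U

private
  variable
    a b c p q ℓ ℓ₁ ℓ₂ : Level
    A : Set a
    B : Set b
    C : Set c
    P : Set p
    Q : Set q

-- Indicators and finite sums

⟦_⟧ : Dec P → ℕ
⟦ p? ⟧ = if does p? then 1 else 0

⟦⟧-yes : (p? : Dec P) → P → ⟦ p? ⟧ ≡ 1
⟦⟧-yes (yes _) _ = refl
⟦⟧-yes (no ¬p) p = contradiction p ¬p

⟦⟧-no : (p? : Dec P) → ¬ P → ⟦ p? ⟧ ≡ 0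
⟦⟧-no (yes p) ¬p = contradiction p ¬p
⟦⟧-no (no _)  _  = refl

⟦⟧-cong : (p? : Dec P) (q? : Dec Q) → (P → Q) → (Q → P) → ⟦ p? ⟧ ≡ ⟦ q? ⟧
⟦⟧-cong (yes p) q? f g = sym (⟦⟧-yes q? (f p))
⟦⟧-cong (no ¬p) q? f g = sym (⟦⟧-no q? (¬p ∘ g))

⟦⟧-× : (p? : Dec P) (q? : Dec Q) → ⟦ p? ×-dec q? ⟧ ≡ ⟦ p? ⟧ * ⟦ q? ⟧
⟦⟧-× (yes _) q? = sym (+-identityʳ _)
⟦⟧-× (no _)  q? = refl

⟦⟧-⊎ : (p? : Dec P) (q? : Dec Q) → ¬ (P × Q) → ⟦ p? ⊎-dec q? ⟧ ≡ ⟦ p? ⟧ + ⟦ q? ⟧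
⟦⟧-⊎ (yes p) q? ¬pq = cong suc (sym (⟦⟧-no q? (λ q → ¬pq (p , q))))
⟦⟧-⊎ (no _)  q? ¬pq = refl

∑ : List A → (A → ℕ) → ℕ
∑ xs f = sum (map f xs)

∑-cong : ∀ (xs : List A) {f g : A → ℕ} → (∀ x → f x ≡ g x) → ∑ xs f ≡ ∑ xs g
∑-cong xs f≗g = cong sum (map-cong f≗g xs)

∑-mono : ∀ (xs : List A) {f g : A → ℕ} → (∀ x → f x ≤ g x) → ∑ xs f ≤ ∑ xs g
∑-mono []       f≤g = z≤n
∑-mono (x ∷ xs) f≤g = +-mono-≤ (f≤g x) (∑-mono xs f≤g)

∑-+ : ∀ (xs : List A) (f g : A → ℕ) → ∑ xs (λ x → f x + g x) ≡ ∑ xs f + ∑ xs g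
∑-+ []       f g = refl
∑-+ (x ∷ xs) f g = begin
  f x + g x + ∑ xs (λ x → f x + g x)  ≡⟨ cong (f x + g x +_) (∑-+ xs f g) ⟩
  f x + g x + (∑ xs f + ∑ xs g)       ≡⟨ interchange (f x) (g x) _ _ ⟩
  f x + ∑ xs f + (g x + ∑ xs g)       ∎
  where
  open ≡-Reasoning
  interchange : ∀ i j k l → i + j + (k + l) ≡ i + k + (j + l)
  interchange = solve-∀

∑-*ˡ : ∀ (xs : List A) k (f : A → ℕ) → ∑ xs (λ x → k * f x) ≡ k * ∑ xs f
∑-*ˡ []       k f = sym (*-zeroʳ k)
∑-*ˡ (x ∷ xs) k f =
  trans (cong (k * f x +_) (∑-*ˡ xs k f)) (sym (*-distribˡ-+ k (f x) _))

∑-0 : ∀ (xs : List A) → ∑ xs (λ _ → 0) ≡ 0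
∑-0 []       = refl
∑-0 (x ∷ xs) = ∑-0 xs

-- Counting in lists and unique positions.

module _ {P : A → Set p} (P? : U.Decidable P) where

  count : List A → ℕ
  count xs = ∑ xs (λ x → ⟦ P? x ⟧)

  count≢0⇒Any : ∀ xs → count xs ≢ 0 → Any P xs
  count≢0⇒Any []       ≢0 = contradiction refl ≢0
  count≢0⇒Any (x ∷ xs) ≢0 with P? x
  ... | yes px = here px
  ... | no _   = there (count≢0⇒Any xs ≢0)

  count≡0⇒¬lookup : ∀ xs → count xs ≡ 0 → ∀ i → ¬ P (lookup xs i)
  count≡0⇒¬lookup (x ∷ xs) ≡0 i with P? x
  count≡0⇒¬lookup (x ∷ xs) ≡0 zero    | no ¬px = ¬px
  count≡0⇒¬lookup (x ∷ xs) ≡0 (suc i) | no ¬px = count≡0⇒¬lookup xs ≡0 i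

  ¬lookup⇒count≡0 : ∀ xs → (∀ i → ¬ P (lookup xs i)) → count xs ≡ 0
  ¬lookup⇒count≡0 []       ¬P = refl
  ¬lookup⇒count≡0 (x ∷ xs) ¬P =
    cong₂ _+_ (⟦⟧-no (P? x) (¬P zero)) (¬lookup⇒count≡0 xs (¬P ∘ suc))

  -- With its converse below, this translates between the unique positions demanded by
  -- `TraversesEachEdgeOnce` and numbers that can be summed.
  count≡1⇒∃! : ∀ xs → count xs ≡ 1 → ∃! _≡_ (λ i → P (lookup xs i))
  count≡1⇒∃! (x ∷ xs) ≡1 with P? x
  ... | yes px = zero , px , first _
    where
    first : ∀ j → P (lookup (x ∷ xs) j) → zero ≡ j
    first zero    _ = refl
    first (suc j) p = contradiction p (count≡0⇒¬lookup xs (ℕ.suc-injective ≡1) j)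
  ... | no ¬px with i , pi , i-unique ← count≡1⇒∃! xs ≡1 = suc i , pi , later _
    where
    later : ∀ j → P (lookup (x ∷ xs) j) → suc i ≡ j
    later zero    p = contradiction p ¬px
    later (suc j) p = cong suc (i-unique p)

  ∃!⇒count≡1 : ∀ xs → ∃! _≡_ (λ i → P (lookup xs i)) → count xs ≡ 1
  ∃!⇒count≡1 (x ∷ xs) (zero , px , unique) = cong₂ _+_ (⟦⟧-yes (P? x) px)
    (¬lookup⇒count≡0 xs λ j p → contradiction (unique {suc j} p) λ ())
  ∃!⇒count≡1 (x ∷ xs) (suc i , pi , unique) = cong₂ _+_
    (⟦⟧-no (P? x) λ p → contradiction (unique {zero} p) λ ())
    (∃!⇒count≡1 xs (i , pi , λ p → Fin.suc-injective (unique p)))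

double : ∀ n → n + n ≡ n * 2
double = solve-∀

-- Saying by a count that each element is listed once up to `≈` makes sums over the list sums over
-- the setoid, and passes easily to subsets and products.
record Enumeration (A : Setoid a ℓ) : Set (a ⊔ ℓ) where
  open Setoid A using (Carrier; _≈_)
  infix 4 _≟_
  field
    _≟_      : Decidable _≈_
    elements : List Carrier
    once     : ∀ x → count (x ≟_) elements ≡ 1

  size : ℕ
  size = ∑ elements (λ _ → 1)

  -- The list contains only an equal copy of a witness, whence the need for `Respects`.
  ∃? : {P : Carrier → Set p} → U.Decidable P → P Respects _≈_ → Dec (∃ P)
  ∃? P? resp = map′ Any.satisfied
    (λ (x , px) → Any.map (λ x≈y → resp x≈y px)
      (count≢0⇒Any (x ≟_) elements λ ≡0 → contradiction (trans (sym ≡0) (once x)) λ ()))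
    (any? P? elements)

-- Euler's theorem

module Euler (Γ : SimpleGraph c ℓ₁ ℓ₂) (V : Enumeration (SimpleGraph.vertices Γ))
             (_~?_ : Decidable (SimpleGraph._~_ Γ)) where

  open SimpleGraph Γ
  open Enumeration V
  private
    module ≈ = Setoid vertices
    variable
      s t u v w x y : Vertex

  -- Degrees and the parity of walks.

  degree : Vertex → ℕ
  degree v = count (v ~?_) elements

  ~-respˡ : x ≈ y → x ~ v → y ~ v
  ~-respˡ = proj₂ ~-resp

  ~-respʳ : x ≈ y → v ~ x → v ~ y
  ~-respʳ = proj₁ ~-resp

  sameEdge? : Decidable SameEdge
  sameEdge? (s , t) (x , y) = (s ≟ x ×-dec t ≟ y) ⊎-dec (s ≟ y ×-dec t ≟ x)

  sameEdge-resp : ∀ {e} → u ≈ x → v ≈ y → SameEdge e (u , v) → SameEdge e (x , y)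
  sameEdge-resp u≈x v≈y (inj₁ (p , q)) = inj₁ (≈.trans p u≈x , ≈.trans q v≈y)
  sameEdge-resp u≈x v≈y (inj₂ (p , q)) = inj₂ (≈.trans p v≈y , ≈.trans q u≈x)

  sameEdge-~ : s ~ t → SameEdge (s , t) (x , y) → x ~ y
  sameEdge-~ s~t (inj₁ (p , q)) = ~-respˡ p (~-respʳ q s~t)
  sameEdge-~ s~t (inj₂ (p , q)) = ~-sym (~-respˡ p (~-respʳ q s~t))

  -- A step contributes to the count at x once for each of its ends equal to x; without loops its
  -- two orientations never match the same pair.
  count-sameEdge : s ~ t → ∀ x →
    ∑ elements (λ y → ⟦ sameEdge? (s , t) (x , y) ⟧) ≡ ⟦ s ≟ x ⟧ + ⟦ t ≟ x ⟧
  count-sameEdge {s} {t} s~t x = begin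
    ∑ elements (λ y → ⟦ sameEdge? (s , t) (x , y) ⟧)
      ≡⟨ ∑-cong elements pointwise ⟩
    ∑ elements (λ y → ⟦ s ≟ x ⟧ * ⟦ t ≟ y ⟧ + ⟦ t ≟ x ⟧ * ⟦ s ≟ y ⟧)
      ≡⟨ ∑-+ elements _ _ ⟩
    ∑ elements (λ y → ⟦ s ≟ x ⟧ * ⟦ t ≟ y ⟧) + ∑ elements (λ y → ⟦ t ≟ x ⟧ * ⟦ s ≟ y ⟧)
      ≡⟨ cong₂ _+_ (single s t) (single t s) ⟩
    ⟦ s ≟ x ⟧ + ⟦ t ≟ x ⟧ ∎
    where
    open ≡-Reasoning
    pointwise : ∀ y → ⟦ sameEdge? (s , t) (x , y) ⟧ ≡
                      ⟦ s ≟ x ⟧ * ⟦ t ≟ y ⟧ + ⟦ t ≟ x ⟧ * ⟦ s ≟ y ⟧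
    pointwise y = trans
      (⟦⟧-⊎ (s ≟ x ×-dec t ≟ y) (s ≟ y ×-dec t ≟ x)
        λ ((_ , t≈y) , (s≈y , _)) → ~-irr (≈.trans s≈y (≈.sym t≈y)) s~t)
      (cong₂ _+_ (⟦⟧-× (s ≟ x) (t ≟ y))
        (trans (⟦⟧-× (s ≟ y) (t ≟ x)) (*-comm ⟦ s ≟ y ⟧ ⟦ t ≟ x ⟧)))
    single : ∀ u v → ∑ elements (λ y → ⟦ u ≟ x ⟧ * ⟦ v ≟ y ⟧) ≡ ⟦ u ≟ x ⟧
    single u v = trans (∑-*ˡ elements ⟦ u ≟ x ⟧ _)
      (trans (cong (⟦ u ≟ x ⟧ *_) (once v)) (*-identityʳ _))

  uses : Walk s t → Vertex → Vertex → ℕ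
  uses w x y = count (λ e → sameEdge? e (x , y)) (steps w)

  uses-cong : (w : Walk s t) → u ≈ x → v ≈ y → uses w u v ≡ uses w x y
  uses-cong w u≈x v≈y = ∑-cong (steps w) λ e → ⟦⟧-cong (sameEdge? e _) (sameEdge? e _)
    (sameEdge-resp u≈x v≈y) (sameEdge-resp (≈.sym u≈x) (≈.sym v≈y))

  uses-≁ : (w : Walk s t) → ¬ (x ~ y) → uses w x y ≡ 0
  uses-≁ (nil _)      x≁y = refl
  uses-≁ (cons s~t w) x≁y =
    cong₂ _+_ (⟦⟧-no (sameEdge? _ _) (x≁y ∘ sameEdge-~ s~t)) (uses-≁ w x≁y)

  -- Every passage through x enters and leaves it, so only the two ends of the walk can disturb the
  -- parity at x. Repeated edges do no harm.
  uses-parity : (w : Walk s t) → ∀ x → 2 ∣ ∑ elements (uses w x) + (⟦ s ≟ x ⟧ + ⟦ t ≟ x ⟧)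
  uses-parity {s} {t} (nil s≈t) x =
    divides ⟦ t ≟ x ⟧ (trans
      (cong₂ _+_ (∑-0 elements) (cong (_+ ⟦ t ≟ x ⟧) (⟦⟧-cong (s ≟ x) (t ≟ x)
        (≈.trans (≈.sym s≈t)) (≈.trans s≈t))))
      (double ⟦ t ≟ x ⟧))
  -- Here s counts twice, as an end of the first step and as the start of the walk; the other end u
  -- of that step becomes the start of the remaining walk.
  uses-parity {s} {t} (cons {y = u} s~u w) x = subst (2 ∣_) (sym eq)
    (∣m∣n⇒∣m+n (divides ⟦ s ≟ x ⟧ refl) (uses-parity w x))
    where
    open ≡-Reasoning
    rearrange : ∀ i j k d → i + j + d + (i + k) ≡ i * 2 + (d + (j + k))
    rearrange = solve-∀
    eq : ∑ elements (uses (cons s~u w) x) + (⟦ s ≟ x ⟧ + ⟦ t ≟ x ⟧) ≡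
         ⟦ s ≟ x ⟧ * 2 + (∑ elements (uses w x) + (⟦ u ≟ x ⟧ + ⟦ t ≟ x ⟧))
    eq = begin
      ∑ elements (uses (cons s~u w) x) + (⟦ s ≟ x ⟧ + ⟦ t ≟ x ⟧)
        ≡⟨ cong (_+ (⟦ s ≟ x ⟧ + ⟦ t ≟ x ⟧)) (∑-+ elements _ _) ⟩
      ∑ elements (λ y → ⟦ sameEdge? (s , u) (x , y) ⟧) + ∑ elements (uses w x)
        + (⟦ s ≟ x ⟧ + ⟦ t ≟ x ⟧)
        ≡⟨ cong (λ k → k + ∑ elements (uses w x) + (⟦ s ≟ x ⟧ + ⟦ t ≟ x ⟧))
             (count-sameEdge s~u x) ⟩
      ⟦ s ≟ x ⟧ + ⟦ u ≟ x ⟧ + ∑ elements (uses w x) + (⟦ s ≟ x ⟧ + ⟦ t ≟ x ⟧)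
        ≡⟨ rearrange ⟦ s ≟ x ⟧ ⟦ u ≟ x ⟧ ⟦ t ≟ x ⟧ _ ⟩
      ⟦ s ≟ x ⟧ * 2 + (∑ elements (uses w x) + (⟦ u ≟ x ⟧ + ⟦ t ≟ x ⟧)) ∎

  -- For a closed walk the two end terms of `uses-parity` agree and cancel modulo 2; as each edge is
  -- used once, what remains is the degree.
  eulerian⇒even-degree : Eulerian → ∀ x → 2 ∣ degree x
  eulerian⇒even-degree (_ , s , w , once-each) x =
    subst (2 ∣_) (∑-cong elements uses≡)
      (∣m+n∣m⇒∣n (subst (2 ∣_) (ℕ.+-comm (∑ elements (uses w x)) _) (uses-parity w x))
        (divides ⟦ s ≟ x ⟧ (double ⟦ s ≟ x ⟧)))
    where
    uses≡ : ∀ y → uses w x y ≡ ⟦ x ~? y ⟧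
    uses≡ y with x ~? y
    ... | yes x~y = ∃!⇒count≡1 (λ e → sameEdge? e (x , y)) (steps w) (once-each x y x~y)
    ... | no x≁y  = uses-≁ w x≁y

  -- Joining and splitting walks.

  restart : s ≈ u → Walk u t → Walk s t
  restart s≈u (nil u≈t)    = nil (≈.trans s≈u u≈t)
  restart s≈u (cons u~v w) = cons (~-respˡ (≈.sym s≈u) u~v) w

  uses-restart : (s≈u : s ≈ u) (w : Walk u t) → ∀ x y → uses (restart s≈u w) x y ≡ uses w x y
  uses-restart s≈u (nil _)    x y = refl
  uses-restart s≈u (cons _ w) x y = cong (_+ uses w x y)
    (⟦⟧-cong (sameEdge? _ _) (sameEdge? _ _) (change s≈u) (change (≈.sym s≈u)))
    where
    change : ∀ {s u v} → s ≈ u → SameEdge (s , v) (x , y) → SameEdge (u , v) (x , y)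
    change s≈u (inj₁ (p , q)) = inj₁ (≈.trans (≈.sym s≈u) p , q)
    change s≈u (inj₂ (p , q)) = inj₂ (≈.trans (≈.sym s≈u) p , q)

  infixr 5 _⁀_
  _⁀_ : Walk s u → Walk u t → Walk s t
  nil s≈u    ⁀ w′ = restart s≈u w′
  cons s~v w ⁀ w′ = cons s~v (w ⁀ w′)

  uses-⁀ : (w : Walk s u) (w′ : Walk u t) → ∀ x y →
           uses (w ⁀ w′) x y ≡ uses w x y + uses w′ x y
  uses-⁀ (nil s≈u)  w′ x y = uses-restart s≈u w′ x y
  uses-⁀ (cons {s} {v} _ w) w′ x y =
    trans (cong (⟦ sameEdge? (s , v) (x , y) ⟧ +_) (uses-⁀ w w′ x y))
          (sym (ℕ.+-assoc ⟦ sameEdge? (s , v) (x , y) ⟧ _ _))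

  -- Only edge multiplicities are remembered, not that the two pieces compose to `w`: rotation needs
  -- no more.
  record Through (w : Walk s t) (u : Vertex) : Set (c ⊔ ℓ₁ ⊔ ℓ₂) where
    field
      before     : Walk s u
      after      : Walk u t
      uses-split : ∀ x y → uses before x y + uses after x y ≡ uses w x y

  through-start : (w : Walk s t) → s ≈ u → Through w u
  through-start w s≈u = record
    { before     = nil s≈u
    ; after      = restart (≈.sym s≈u) w
    ; uses-split = uses-restart (≈.sym s≈u) w
    }

  -- Cut at the first step over the edge: after that step if it runs from x to y, before it if it
  -- runs from y to x.
  through-used : (w : Walk s t) → uses w x y ≢ 0 → Through w y
  through-used (nil _) used = contradiction refl used
  through-used {x = x} {y} (cons {s} {v} s~v w) used with sameEdge? (s , v) (x , y)
  ... | yes (inj₁ (_ , v≈y)) = record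
    { before     = cons s~v (nil v≈y)
    ; after      = restart (≈.sym v≈y) w
    ; uses-split = λ x y → cong₂ _+_ (+-identityʳ _) (uses-restart (≈.sym v≈y) w x y)
    }
  ... | yes (inj₂ (s≈y , _)) = through-start (cons s~v w) s≈y
  ... | no unequal = record
    { before     = cons s~v before
    ; after      = after
    ; uses-split = λ x y → trans (ℕ.+-assoc ⟦ sameEdge? (s , v) (x , y) ⟧ _ _)
                                 (cong (⟦ sameEdge? (s , v) (x , y) ⟧ +_) (uses-split x y))
    }
    where
    open Through (through-used w λ unused →
      used (cong₂ _+_ (⟦⟧-no (sameEdge? (s , v) (x , y)) unequal) unused))

  Free : Walk s t → Vertex → Vertex → Set ℓ₂
  Free w x y = x ~ y × uses w x y ≡ 0

  free? : (w : Walk s t) → Decidable (Free w)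
  free? w x y = x ~? y ×-dec uses w x y ℕ.≟ 0

  free-resp : (w : Walk s t) → u ≈ x → v ≈ y → Free w u v → Free w x y
  free-resp w u≈x v≈y (u~v , unused) =
    ~-respˡ u≈x (~-respʳ v≈y u~v) , trans (sym (uses-cong w u≈x v≈y)) unused

  ∃free? : (w : Walk s t) → ∀ x → Dec (∃ (Free w x))
  ∃free? w x = ∃? (free? w x) (free-resp w ≈.refl)

  -- Following any walk p from a visited vertex to x, either every edge of p is
  -- used, so that x is visited too, or the first unused edge is free.
  reach-free : (w : Walk s t) → ∃ (Free w x) → Through w u → Walk u x →
               ∃ λ v → Through w v × ∃ (Free w v)
  reach-free {x = x} {u} w (y , free) thru (nil u≈x) =
    u , thru , y , free-resp w (≈.sym u≈x) ≈.refl free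
  reach-free {u = u} w free thru (cons {y = v} u~v p) with uses w u v ℕ.≟ 0
  ... | yes unused = u , thru , v , u~v , unused
  ... | no used    = reach-free w free (through-used w used) p

  -- Trails and their extension.

  IsTrail : Walk s t → Set c
  IsTrail w = ∀ x y → uses w x y ≤ 1

  -- Twice the number of steps, since each step is counted at both ordered pairs of its ends. For a
  -- trail the number of all ordered pairs, `capacity`, is a bound.
  total : Walk s t → ℕ
  total w = ∑ elements λ x → ∑ elements (uses w x)

  capacity : ℕ
  capacity = ∑ elements λ _ → size

  total≤capacity : (w : Walk s t) → IsTrail w → total w ≤ capacity
  total≤capacity w trail = ∑-mono elements λ x → ∑-mono elements (trail x)

  snoc : Walk s t → t ~ u → Walk s u
  snoc w t~u = w ⁀ cons t~u (nil ≈.refl)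

  uses-snoc : (w : Walk s t) (t~u : t ~ u) → ∀ x y →
              uses (snoc w t~u) x y ≡ ⟦ sameEdge? (t , u) (x , y) ⟧ + uses w x y
  uses-snoc w t~u x y = trans (uses-⁀ w (cons t~u (nil ≈.refl)) x y)
    (trans (cong (uses w x y +_) (+-identityʳ _)) (ℕ.+-comm (uses w x y) _))

  snoc-trail : (w : Walk s t) → IsTrail w → ((t~u , _) : Free w t u) → IsTrail (snoc w t~u)
  snoc-trail {t = t} {u} w trail (t~u , unused) x y =
    subst (_≤ 1) (sym (uses-snoc w t~u x y)) (bound (sameEdge? (t , u) (x , y)))
    where
    -- Freeness speaks of one orientation of the new edge, while the bound below must hold for both.
    symm : uses w u t ≡ uses w t u
    symm = ∑-cong (steps w) λ e → ⟦⟧-cong (sameEdge? e _) (sameEdge? e _) flip flip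
      where
      flip : ∀ {e u t} → SameEdge e (u , t) → SameEdge e (t , u)
      flip (inj₁ p) = inj₂ p
      flip (inj₂ p) = inj₁ p
    bound : (same? : Dec (SameEdge (t , u) (x , y))) → ⟦ same? ⟧ + uses w x y ≤ 1
    bound (no _) = trail x y
    bound (yes (inj₁ (t≈x , u≈y))) =
      ℕ.≤-reflexive (cong suc (trans (sym (uses-cong w t≈x u≈y)) unused))
    bound (yes (inj₂ (t≈y , u≈x))) =
      ℕ.≤-reflexive (cong suc (trans (sym (uses-cong w u≈x t≈y)) (trans symm unused)))

  total-snoc : (w : Walk s t) (t~u : t ~ u) → total (snoc w t~u) ≡ 2 + total w
  total-snoc {t = t} {u} w t~u = begin
    total (snoc w t~u)
      ≡⟨ ∑-cong elements (λ x → ∑-cong elements (uses-snoc w t~u x)) ⟩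
    ∑ elements (λ x → ∑ elements (λ y → ⟦ sameEdge? (t , u) (x , y) ⟧ + uses w x y))
      ≡⟨ ∑-cong elements (λ x → trans (∑-+ elements _ _)
           (cong (_+ ∑ elements (uses w x)) (count-sameEdge t~u x))) ⟩
    ∑ elements (λ x → ⟦ t ≟ x ⟧ + ⟦ u ≟ x ⟧ + ∑ elements (uses w x))
      ≡⟨ ∑-+ elements _ _ ⟩
    ∑ elements (λ x → ⟦ t ≟ x ⟧ + ⟦ u ≟ x ⟧) + total w
      ≡⟨ cong (_+ total w) (trans (∑-+ elements _ _) (cong₂ _+_ (once t) (once u))) ⟩
    2 + total w ∎
    where open ≡-Reasoning

  -- Construction of an Eulerian circuit.

  module _ (connected : Connected) (even : ∀ x → 2 ∣ degree x) where

    -- A trail uses an odd number of the edges at the end of an open walk.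
    open-free : (w : Walk s t) → IsTrail w → ¬ (s ≈ t) → ∃ (Free w t)
    open-free {s} {t} w trail s≉t = decidable-stable (∃free? w t) λ stuck →
      contradiction (∣1⇒≡1 (∣m+n∣m⇒∣n (even+1 stuck) (even t))) λ ()
      where
      -- If no edge at t is free, the trail uses each of them exactly once, so the parity at the
      -- open end t would make the degree odd.
      saturated : ¬ ∃ (Free w t) → ∀ y → uses w t y ≡ ⟦ t ~? y ⟧
      saturated stuck y with t ~? y
      ... | no t≁y  = uses-≁ w t≁y
      ... | yes t~y = ℕ.≤-antisym (trail t y) (ℕ.n≢0⇒n>0 λ unused → stuck (y , t~y , unused))
      even+1 : ¬ ∃ (Free w t) → 2 ∣ degree t + 1
      even+1 stuck = subst (2 ∣_)
        (cong₂ _+_ (∑-cong elements (saturated stuck))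
          (cong₂ _+_ (⟦⟧-no (s ≟ t) s≉t) (⟦⟧-yes (t ≟ t) ≈.refl)))
        (uses-parity w t)

    ∃free-closed? : (w : Walk s t) → Dec (∃ λ x → ∃ (Free w x))
    ∃free-closed? w = ∃? (∃free? w) λ x≈y (v , free) → v , free-resp w x≈y ≈.refl free

    complete : (w : Walk s s) → IsTrail w → ¬ (∃ λ x → ∃ (Free w x)) → TraversesEachEdgeOnce w
    complete w trail none x y x~y = count≡1⇒∃! (λ e → sameEdge? e (x , y)) (steps w)
      (ℕ.≤-antisym (trail x y) (ℕ.n≢0⇒n>0 λ unused → none (x , y , x~y , unused)))

    -- The ends are equal only up to `≈`, so the walk is retyped before it can be rotated.
    close : (w : Walk s t) → s ≈ t → Walk s s
    close w s≈t = w ⁀ nil (≈.sym s≈t)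

    uses-close : (w : Walk s t) (s≈t : s ≈ t) → ∀ x y → uses (close w s≈t) x y ≡ uses w x y
    uses-close w s≈t x y = trans (uses-⁀ w (nil (≈.sym s≈t)) x y) (+-identityʳ _)

    module _ {w : Walk s s} {u} (thru : Through w u) where
      open Through thru

      -- The same circuit read from u, which makes a free edge at u available at its end.
      rotate : Walk u u
      rotate = after ⁀ before

      uses-rotate : ∀ x y → uses rotate x y ≡ uses w x y
      uses-rotate x y = trans (uses-⁀ after before x y)
        (trans (ℕ.+-comm (uses after x y) _) (uses-split x y))

    mutual
      -- Termination rests on the invariant `capacity < total w + fuel`: a trail cannot exceed
      -- `capacity`, so the fuel outlasts the extensions.
      grow : ∀ fuel (w : Walk s t) → IsTrail w → capacity < total w + fuel →
             ∃ λ x → Σ (Walk x x) TraversesEachEdgeOnce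
      grow {s} {t} fuel w trail enough with s ≟ t
      ... | no s≉t = push fuel w trail enough (proj₂ (open-free w trail s≉t))
      ... | yes s≈t with ∃free-closed? (close w s≈t)
      ...   | no none = s , close w s≈t , complete (close w s≈t)
                (λ x y → subst (_≤ 1) (sym (uses-close w s≈t x y)) (trail x y)) none
      ...   | yes (x , free)
              with u , thru , _ , u~v , unused ←
                     reach-free (close w s≈t) free (through-start _ ≈.refl) (connected s x) =
        push fuel (rotate thru)
          (λ x y → subst (_≤ 1) (sym (uses≡ x y)) (trail x y))
          (subst (λ k → capacity < k + fuel)
            (sym (∑-cong elements λ x → ∑-cong elements (uses≡ x))) enough)
          (u~v , trans (uses-rotate thru _ _) unused)
        where
        uses≡ : ∀ x y → uses (rotate thru) x y ≡ uses w x y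
        uses≡ x y = trans (uses-rotate thru x y) (uses-close w s≈t x y)

      push : ∀ fuel (w : Walk s t) → IsTrail w → capacity < total w + fuel → Free w t u →
             ∃ λ x → Σ (Walk x x) TraversesEachEdgeOnce
      push zero w trail enough _ = contradiction
        (subst (capacity <_) (+-identityʳ _) enough) (ℕ.≤⇒≯ (total≤capacity w trail))
      push (suc fuel) w trail enough free@(t~u , _) =
        -- One unit of fuel is spent and `total` grows by 2, so the invariant survives with one to
        -- spare.
        grow fuel (snoc w t~u) (snoc-trail w trail free)
          (ℕ.≤-trans (ℕ.m≤n⇒m≤1+n enough)
            (ℕ.≤-reflexive (trans (shift (total w) fuel) (cong (_+ fuel) (sym (total-snoc w t~u))))))
        where
        shift : ∀ m n → suc (m + suc n) ≡ 2 + m + n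
        shift = solve-∀

    even-degree⇒eulerian : Vertex → Eulerian
    even-degree⇒eulerian x = connected ,
      -- The empty trail at the given vertex starts the process; its fuel alone already exceeds
      -- `capacity`.
      grow (suc capacity) (nil {x} ≈.refl) (λ _ _ → z≤n) (ℕ.m≤n+m (suc capacity) _)

-- Enumerations of finite sets, subsets and products

∑-tabulate-single : ∀ {k} (f : Fin k → A) (g : A → ℕ) i →
  g (f i) ≡ 1 → (∀ j → i ≢ j → g (f j) ≡ 0) → ∑ (tabulate f) g ≡ 1
∑-tabulate-single {k = suc k} f g zero    one others = cong₂ _+_ one
  (trans (cong sum (trans (map-tabulate (f ∘ suc) g) (tabulate-cong λ j → others (suc j) λ ())))
         (sum-zeros k))
  where
  sum-zeros : ∀ k → sum (tabulate {n = k} λ _ → 0) ≡ 0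
  sum-zeros zero    = refl
  sum-zeros (suc k) = sum-zeros k
∑-tabulate-single             f g (suc i) one others = cong₂ _+_ (others zero λ ())
  (∑-tabulate-single (f ∘ suc) g i one λ j i≢j → others (suc j) (i≢j ∘ Fin.suc-injective))

∑-tabulate-1 : ∀ {k} (f : Fin k → A) → ∑ (tabulate f) (λ _ → 1) ≡ k
∑-tabulate-1 {k = zero}  f = refl
∑-tabulate-1 {k = suc k} f = cong suc (∑-tabulate-1 (f ∘ suc))

module _ {A : Setoid a ℓ} {k} (A↔k : HasSize A k) where
  open Setoid A using () renaming (sym to ≈-sym; trans to ≈-trans)
  open Inverse A↔k

  from-injective : ∀ {x y} → from x ≡ from y → Setoid._≈_ A x y
  from-injective {x} {y} eq = ≈-trans (≈-sym (strictlyInverseˡ x))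
    (≈-trans (to-cong eq) (strictlyInverseˡ y))

  to-injective : ∀ {i j} → Setoid._≈_ A (to i) (to j) → i ≡ j
  to-injective {i} {j} eq =
    trans (sym (strictlyInverseʳ i)) (trans (from-cong eq) (strictlyInverseʳ j))

  enumerate : Enumeration A
  enumerate = record
    { _≟_      = _≈?_
    ; elements = tabulate to
    ; once     = λ x → ∑-tabulate-single to _ (from x)
        (⟦⟧-yes (x ≈? to (from x)) (≈-sym (strictlyInverseˡ x)))
        (λ j ≢j → ⟦⟧-no (x ≈? to j) λ x≈ → ≢j (trans (from-cong x≈) (strictlyInverseʳ j)))
    }
    where
    _≈?_ : Decidable (Setoid._≈_ A)
    x ≈? y = map′ from-injective from-cong (from x Fin.≟ from y)

  size-enumerate : Enumeration.size enumerate ≡ k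
  size-enumerate = ∑-tabulate-1 to

module _ {A : Set a} {P : A → Set p} (P? : U.Decidable P) where

  restrict : List A → List (Σ A P)
  restrict []       = []
  restrict (x ∷ xs) with P? x
  ... | yes px = (x , px) ∷ restrict xs
  ... | no _   = restrict xs

  -- Sums over the vertices thereby become weighted sums over the whole product, where they can be
  -- compared with other counts.
  ∑-restrict : ∀ xs (f : A → ℕ) → ∑ (restrict xs) (f ∘ proj₁) ≡ ∑ xs (λ x → ⟦ P? x ⟧ * f x)
  ∑-restrict []       f = refl
  ∑-restrict (x ∷ xs) f with P? x
  ... | yes px = cong₂ _+_ (sym (+-identityʳ (f x))) (∑-restrict xs f)
  ... | no _   = ∑-restrict xs f

module _ {A : Setoid a ℓ} (E : Enumeration A) {P : Setoid.Carrier A → Set p}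
         (P? : U.Decidable P) (resp : P Respects Setoid._≈_ A) where
  open Enumeration E

  subset : Enumeration (On.setoid A (proj₁ {B = P}))
  subset = record
    { _≟_      = λ x y → proj₁ x ≟ proj₁ y
    ; elements = restrict P? elements
    ; once     = λ (x , px) → trans (∑-restrict P? elements λ y → ⟦ x ≟ y ⟧)
        (trans (∑-cong elements λ y → trans (sym (⟦⟧-× (P? y) (x ≟ y)))
                  -- Whatever equals x satisfies `P` too, so the filter loses no copy of x.
                  (⟦⟧-cong (P? y ×-dec x ≟ y) (x ≟ y) proj₂ (λ x≈y → resp x≈y px , x≈y)))
               (once x))
    }

-- Finite products and parity.

Π : ∀ {n} → (Fin n → ℕ) → ℕ
Π f = product (tabulate f)

Π-cong : ∀ {n} {f g : Fin n → ℕ} → (∀ i → f i ≡ g i) → Π f ≡ Π g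
Π-cong f≗g = cong product (tabulate-cong f≗g)

Π-1 : ∀ n → Π {n} (λ _ → 1) ≡ 1
Π-1 zero    = refl
Π-1 (suc n) = trans (+-identityʳ _) (Π-1 n)

⟦⟧-all : ∀ {n} {P : Fin n → Set p} (P? : U.Decidable P) → ⟦ Fin.all? P? ⟧ ≡ Π (λ i → ⟦ P? i ⟧)
⟦⟧-all {n = zero}  P? = refl
⟦⟧-all {n = suc n} P? = trans
  (⟦⟧-cong (Fin.all? P?) (P? zero ×-dec Fin.all? (P? ∘ suc))
    (λ ∀P → ∀P zero , ∀P ∘ suc) (λ (P₀ , ∀P) → Fin.∀-cons P₀ ∀P))
  (trans (⟦⟧-× (P? zero) (Fin.all? (P? ∘ suc))) (cong (⟦ P? zero ⟧ *_) (⟦⟧-all (P? ∘ suc))))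

Π-even : ∀ {n} (f : Fin n → ℕ) i → 2 ∣ f i → 2 ∣ Π f
Π-even f zero    even = ∣m⇒∣m*n _ even
Π-even f (suc i) even = ∣n⇒∣m*n (f zero) (Π-even (f ∘ suc) i even)

Π-odd : ∀ {n} (f : Fin n → ℕ) → (∀ i → 2 ∤ f i) → 2 ∤ Π f
Π-odd {zero}  f odd 2∣1 = contradiction (∣1⇒≡1 2∣1) λ ()
Π-odd {suc n} f odd 2∣Π =
  [ odd zero , Π-odd (f ∘ suc) (odd ∘ suc) ]′ (euclidsLemma (f zero) _ prime[2] 2∣Π)

even⊎odd : ∀ n → 2 ∣ n ⊎ 2 ∣ suc n
even⊎odd zero    = inj₁ (2 ∣0)
even⊎odd (suc n) with even⊎odd n
... | inj₁ 2∣n  = inj₂ (∣m∣n⇒∣m+n ∣-refl 2∣n)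
... | inj₂ 2∣1+n = inj₁ 2∣1+n

odd⇒even-suc : ∀ n → 2 ∤ n → 2 ∣ suc n
odd⇒even-suc n odd = [ (λ even → contradiction even odd) , id ]′ (even⊎odd n)

even⇒odd-suc : ∀ n → 2 ∣ n → 2 ∤ suc n
even⇒odd-suc n 2∣n 2∣1+n = contradiction
  (∣1⇒≡1 (∣m+n∣m⇒∣n (subst (2 ∣_) (ℕ.+-comm 1 n) 2∣1+n) 2∣n)) λ ()

-- Sums over dependent functions.

∑-cartesianProductWith : ∀ (h : A → B → C) xs ys (f : C → ℕ) →
  ∑ (cartesianProductWith h xs ys) f ≡ ∑ xs (λ x → ∑ ys (λ y → f (h x y)))
∑-cartesianProductWith h []       ys f = refl
∑-cartesianProductWith h (x ∷ xs) ys f = trans (cong sum (map-++ f (map (h x) ys) _))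
  (trans (sum-++ (map f (map (h x) ys)) _)
    (cong₂ _+_ (cong sum (sym (map-∘ ys))) (∑-cartesianProductWith h xs ys f)))

functions : ∀ {n} {A : Fin n → Set a} → (∀ i → List (A i)) → List (∀ i → A i)
functions {n = zero}  xs = (λ ()) ∷ []
functions {n = suc n} {A} xs =
  cartesianProductWith (Fin.∀-cons {P = A}) (xs zero) (functions (xs ∘ suc))

-- Distributivity: expanding a product of sums chooses one summand from each factor, that is, one
-- function. Sizes, multiplicities and annihilators in a product all factor by it.
∑-functions : ∀ {n} {A : Fin n → Set a} (xs : ∀ i → List (A i)) (g : ∀ i → A i → ℕ) →
  ∑ (functions xs) (λ f → Π (λ i → g i (f i))) ≡ Π (λ i → ∑ (xs i) (g i))
∑-functions {n = zero}  xs g = refl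
∑-functions {n = suc n} {A} xs g = begin
  ∑ (functions xs) (λ f → Π (λ i → g i (f i)))
    ≡⟨ ∑-cartesianProductWith (Fin.∀-cons {P = A}) (xs zero) _ _ ⟩
  ∑ (xs zero) (λ x → ∑ (functions (xs ∘ suc)) (λ f → g zero x * Π (λ i → g (suc i) (f i))))
    ≡⟨ ∑-cong (xs zero) (λ x → trans (∑-*ˡ (functions (xs ∘ suc)) (g zero x) _)
         (trans (cong (g zero x *_) (∑-functions (xs ∘ suc) (g ∘ suc))) (*-comm (g zero x) _))) ⟩
  ∑ (xs zero) (λ x → tail * g zero x)
    ≡⟨ trans (∑-*ˡ (xs zero) tail (g zero)) (*-comm tail _) ⟩
  Π (λ i → ∑ (xs i) (g i)) ∎
  where
  open ≡-Reasoning
  tail : ℕ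
  tail = Π (λ i → ∑ (xs (suc i)) (g (suc i)))

open BoundedSemilattice using (_≈_; 0#; 1#; setoid; poset)

module _ {n} (S : Fin n → BoundedSemilattice c ℓ) (E : ∀ i → Enumeration (setoid (S i))) where
  private
    module E i = Enumeration (E i)

  enumerate-∏ : Enumeration (setoid (∏ S))
  enumerate-∏ = record
    { _≟_      = λ x y → Fin.all? λ i → E._≟_ i (x i) (y i)
    ; elements = functions E.elements
    ; once     = λ x → trans
        (∑-cong (functions E.elements) λ y → ⟦⟧-all λ i → E._≟_ i (x i) (y i))
        (trans (∑-functions E.elements λ i y → ⟦ E._≟_ i (x i) y ⟧)
          (trans (Π-cong λ i → E.once i (x i)) (Π-1 n)))
    }

  size-enumerate-∏ : Enumeration.size enumerate-∏ ≡ Π E.size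
  size-enumerate-∏ = trans
    (∑-cong (functions E.elements) λ _ → sym (Π-1 n)) (∑-functions E.elements λ _ _ → 1)

-- Finite chains

module FiniteChains (S : BoundedSemilattice c ℓ) (chain : IsChain S) where
  open BoundedSemilattice S using (Carrier; _·_)
    renaming (_≈_ to _≈ˢ_; 0# to 0ˢ; 1# to 1ˢ; sym to ≈-sym; trans to ≈-trans)

  -- In a chain a product of two elements is one of them.
  zero-product : ∀ {x y} → (x · y) ≈ˢ 0ˢ → x ≈ˢ 0ˢ ⊎ y ≈ˢ 0ˢ
  zero-product {x} {y} xy≈0 with chain x y
  ... | inj₁ x≤y = inj₁ (≈-trans x≤y xy≈0)
  ... | inj₂ y≤x = inj₂ (≈-trans y≤x (≈-trans (BoundedSemilattice.comm S y x) xy≈0))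

  module _ {k} (size : HasSize (setoid S) k) where
    open Inverse size using (to; from)

    chain-size≤ : ∀ {m} → FiniteChain (poset S) m → m ≤ k
    chain-size≤ C = Fin.injective⇒≤ {f = from ∘ Injection.to elements}
      (Injection.injective elements ∘ from-injective size)
      where open FiniteChain C

    whole : FiniteChain (poset S) k
    whole = record
      { elements   = record
        { to        = to
        ; cong      = Inverse.to-cong size
        ; injective = to-injective size
        }
      ; comparable = λ i j → chain (to i) (to j)
      }

  -- The whole of S is a longest chain, so the length is one less than the size.
  even-length⇔odd-size : ∀ {k} → HasSize (setoid S) k → HasEvenLength (poset S) ⇔ 2 ∤ k
  -- Size zero is impossible, as S contains 0.
  even-length⇔odd-size {zero}  size with () ← Inverse.from size 0ˢ
  even-length⇔odd-size {suc k} size = mk⇔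
    (λ (l , (bound , least) , even) → even⇒odd-suc k
      (subst (2 ∣_) (ℕ.≤-antisym (least k λ _ C → s≤s⁻¹ (chain-size≤ size C))
                                 (bound k (whole size))) even))
    (λ odd → k , ((λ _ C → s≤s⁻¹ (chain-size≤ size C)) , λ m bound → bound k (whole size)) ,
      [ id , (λ even → contradiction even odd) ]′ (even⊎odd k))

  module _ (0≉1 : ¬ 0ˢ ≈ˢ 1ˢ) (E : Enumeration (setoid S)) where
    open Enumeration E

    Proper : Carrier → Set ℓ
    Proper x = ¬ x ≈ˢ 0ˢ × ¬ x ≈ˢ 1ˢ

    proper? : U.Decidable Proper
    proper? x = ¬? (x ≟ 0ˢ) ×-dec ¬? (x ≟ 1ˢ)

    ∑-ends : ∑ elements (λ y → ⟦ 0ˢ ≟ y ⟧ + ⟦ 1ˢ ≟ y ⟧) ≡ 2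
    ∑-ends = trans (∑-+ elements _ _) (cong₂ _+_ (once 0ˢ) (once 1ˢ))

    -- If every element were 0 or 1, the indicators of these two would add up to 1 everywhere and
    -- their sum 2 would be the size.
    size≢2⇒proper : size ≢ 2 → ∃ Proper
    size≢2⇒proper ≢2 = decidable-stable
      (∃? proper? λ x≈y (x≉0 , x≉1) → x≉0 ∘ ≈-trans x≈y , x≉1 ∘ ≈-trans x≈y)
      λ none → ≢2 (trans (∑-cong elements λ y → sym (end none y)) ∑-ends)
      where
      end : ¬ ∃ Proper → ∀ y → ⟦ 0ˢ ≟ y ⟧ + ⟦ 1ˢ ≟ y ⟧ ≡ 1
      end none y = trans (sym (⟦⟧-⊎ (0ˢ ≟ y) (1ˢ ≟ y) λ (p , q) → 0≉1 (≈-trans p (≈-sym q))))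
        (⟦⟧-yes (0ˢ ≟ y ⊎-dec 1ˢ ≟ y) (decidable-stable (0ˢ ≟ y ⊎-dec 1ˢ ≟ y)
          λ neither → none (y , neither ∘ inj₁ ∘ ≈-sym , neither ∘ inj₂ ∘ ≈-sym)))

    -- The indicators of 0, 1 and x are disjoint, so their total 3 is bounded by the size.
    proper⇒3≤size : ∃ Proper → 3 ≤ size
    proper⇒3≤size (x , x≉0 , x≉1) =
      subst (_≤ size) (trans (∑-+ elements _ _) (cong₂ _+_ ∑-ends (once x)))
        (∑-mono elements at-most-one)
      where
      at-most-one : ∀ y → ⟦ 0ˢ ≟ y ⟧ + ⟦ 1ˢ ≟ y ⟧ + ⟦ x ≟ y ⟧ ≤ 1
      at-most-one y with 0ˢ ≟ y | 1ˢ ≟ y | x ≟ y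
      ... | no _  | no _  | no _  = z≤n
      ... | no _  | no _  | yes _ = s≤s z≤n
      ... | no _  | yes _ | no _  = s≤s z≤n
      ... | yes _ | no _  | no _  = s≤s z≤n
      ... | yes p | yes q | _     = contradiction (≈-trans p (≈-sym q)) 0≉1
      ... | yes p | no _  | yes q = contradiction (≈-trans q (≈-sym p)) x≉0
      ... | no _  | yes p | yes q = contradiction (≈-trans q (≈-sym p)) x≉1

third : ∀ {n} → 3 ≤ n → (i j : Fin n) → ∃ λ k → k ≢ i × k ≢ j
third (s≤s (s≤s (s≤s _))) zero          zero          = suc zero       , (λ ()) , λ ()
third (s≤s (s≤s (s≤s _))) zero          (suc zero)    = suc (suc zero) , (λ ()) , λ ()
third (s≤s (s≤s (s≤s _))) zero          (suc (suc _)) = suc zero       , (λ ()) , λ ()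
third (s≤s (s≤s (s≤s _))) (suc zero)    zero          = suc (suc zero) , (λ ()) , λ ()
third (s≤s (s≤s (s≤s _))) (suc (suc _)) zero          = suc zero       , (λ ()) , λ ()
third (s≤s (s≤s (s≤s _))) (suc _)       (suc _)       = zero           , (λ ()) , λ ()

-- The graph of a product of finite chains

module ProductOfChains
  {n} (3≤n : 3 ≤ n) (S : Fin n → BoundedSemilattice c ℓ)
  (0≉1 : ∀ i → ¬ (_≈_ (S i) (0# (S i)) (1# (S i))))
  (finite : ∀ i → IsFinite (setoid (S i)))
  (chain : ∀ i → IsChain (S i)) where

  private
    module S i = BoundedSemilattice (S i)
    module C i = FiniteChains (S i) (chain i)
    module T = BoundedSemilattice (∏ S)

  k : Fin n → ℕ
  k i = proj₁ (finite i)

  E : ∀ i → Enumeration (setoid (S i))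
  E i = enumerate (proj₂ (finite i))

  private
    module E i = Enumeration (E i)

  size-E : ∀ i → E.size i ≡ k i
  size-E i = size-enumerate (proj₂ (finite i))

  open Enumeration (enumerate-∏ S E)

  size≡Πk : size ≡ Π k
  size≡Πk = trans (size-enumerate-∏ S E) (Π-cong size-E)

  IsVertex : T.Carrier → Set ℓ
  IsVertex x = ¬ x T.≈ T.0# × ¬ x T.≈ T.1#

  isVertex? : U.Decidable IsVertex
  isVertex? x = ¬? (x ≟ T.0#) ×-dec ¬? (x ≟ T.1#)

  V : Enumeration (SimpleGraph.vertices (G (∏ S)))
  V = subset (enumerate-∏ S E) isVertex?
    λ x≈y (x≉0 , x≉1) → x≉0 ∘ T.trans x≈y , x≉1 ∘ T.trans x≈y

  adjacent? : (x y : T.Carrier) → Dec (¬ (x T.≈ y) × ¬ (x T.· y T.≈ T.0#))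
  adjacent? x y = ¬? (x ≟ y) ×-dec ¬? ((x T.· y) ≟ T.0#)

  open SimpleGraph (G (∏ S)) using (Vertex; Walk; nil; cons; Connected; Eulerian)
  open Euler (G (∏ S)) V (λ x y → adjacent? (proj₁ x) (proj₁ y))

  -- Degrees and annihilators.

  annihilators : T.Carrier → ℕ
  annihilators x = count (λ y → (x T.· y) ≟ T.0#) elements

  -- Each y of S is exactly one of: a neighbour of x, an annihilator of x (such as 0), x itself, or
  -- 1. The last two account for the 2.
  degree-formula : (v@(x , _) : Vertex) → degree v + (annihilators x + 2) ≡ size
  degree-formula (x , x≉0 , x≉1) = begin
    degree (x , x≉0 , x≉1) + (annihilators x + 2)
      ≡⟨ cong₂ _+_ (∑-restrict isVertex? elements λ y → ⟦ adjacent? x y ⟧)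
           (cong (annihilators x +_) (sym (cong₂ _+_ (once x) (once T.1#)))) ⟩
    ∑ elements (λ y → ⟦ isVertex? y ⟧ * ⟦ adjacent? x y ⟧)
      + (annihilators x + (count (x ≟_) elements + count (T.1# ≟_) elements))
      ≡⟨ cong (∑ elements (λ y → ⟦ isVertex? y ⟧ * ⟦ adjacent? x y ⟧) +_)
           (trans (cong (annihilators x +_) (sym (∑-+ elements _ _))) (sym (∑-+ elements _ _))) ⟩
    ∑ elements (λ y → ⟦ isVertex? y ⟧ * ⟦ adjacent? x y ⟧)
      + ∑ elements (λ y → ⟦ (x T.· y) ≟ T.0# ⟧ + (⟦ x ≟ y ⟧ + ⟦ T.1# ≟ y ⟧))
      ≡⟨ sym (∑-+ elements _ _) ⟩
    ∑ elements (λ y → ⟦ isVertex? y ⟧ * ⟦ adjacent? x y ⟧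
      + (⟦ (x T.· y) ≟ T.0# ⟧ + (⟦ x ≟ y ⟧ + ⟦ T.1# ≟ y ⟧)))
      ≡⟨ ∑-cong elements exactly-one ⟩
    size ∎
    where
    open ≡-Reasoning
    neighbour : ∀ y → ¬ (IsVertex y × ¬ (x T.≈ y) × ¬ (x T.· y T.≈ T.0#)) →
                ⟦ isVertex? y ⟧ * ⟦ adjacent? x y ⟧ ≡ 0
    neighbour y ¬adj = trans (sym (⟦⟧-× (isVertex? y) (adjacent? x y)))
      (⟦⟧-no (isVertex? y ×-dec adjacent? x y) ¬adj)
    exactly-one : ∀ y → ⟦ isVertex? y ⟧ * ⟦ adjacent? x y ⟧
      + (⟦ (x T.· y) ≟ T.0# ⟧ + (⟦ x ≟ y ⟧ + ⟦ T.1# ≟ y ⟧)) ≡ 1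
    exactly-one y = cases ((x T.· y) ≟ T.0#) (x ≟ y) (T.1# ≟ y)
      where
      cases : (xy≟0 : Dec (x T.· y T.≈ T.0#)) (x≟y : Dec (x T.≈ y)) (1≟y : Dec (T.1# T.≈ y)) →
        ⟦ isVertex? y ⟧ * ⟦ adjacent? x y ⟧ + (⟦ xy≟0 ⟧ + (⟦ x≟y ⟧ + ⟦ 1≟y ⟧)) ≡ 1
      -- The first three cases are overlaps: x·x = x and x·1 = x are nonzero, and x is not 1.
      cases (yes xy≈0) (yes x≈y) _ = contradiction
        (T.trans (T.sym (T.idem x)) (T.trans (T.∙-cong T.refl x≈y) xy≈0)) x≉0
      cases (yes xy≈0) (no _) (yes 1≈y) = contradiction
        (T.trans (T.sym (T.identityʳ x)) (T.trans (T.∙-cong T.refl 1≈y) xy≈0)) x≉0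
      cases (no _) (yes x≈y) (yes 1≈y) = contradiction (T.trans x≈y (T.sym 1≈y)) x≉1
      cases (yes xy≈0) (no _) (no _) = cong (_+ 1) (neighbour y λ (_ , _ , xy≉0) → xy≉0 xy≈0)
      cases (no _) (yes x≈y) (no _) = cong (_+ 1) (neighbour y λ (_ , x≉y , _) → x≉y x≈y)
      cases (no _) (no _) (yes 1≈y) = cong (_+ 1) (neighbour y λ ((_ , y≉1) , _) → y≉1 (T.sym 1≈y))
      -- Here y is a neighbour; it is a vertex because y = 0 would force x·y = 0.
      cases (no xy≉0) (no x≉y) (no 1≉y) = cong (_+ 0)
        (trans (sym (⟦⟧-× (isVertex? y) (adjacent? x y)))
          (⟦⟧-yes (isVertex? y ×-dec adjacent? x y)
            (((λ y≈0 → xy≉0 (T.trans (T.∙-cong T.refl y≈0) (proj₂ T.zero x))) , 1≉y ∘ T.sym) ,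
             x≉y , xy≉0)))

  factor : T.Carrier → Fin n → ℕ
  factor x i = count (λ y → E._≟_ i (S._·_ i (x i) y) (S.0# i)) (E.elements i)

  annihilators≡Π : ∀ x → annihilators x ≡ Π (factor x)
  annihilators≡Π x = trans
    (∑-cong elements λ y → ⟦⟧-all λ i → E._≟_ i (S._·_ i (x i) (y i)) (S.0# i))
    (∑-functions E.elements λ i y → ⟦ E._≟_ i (S._·_ i (x i) y) (S.0# i) ⟧)

  factor-zero : ∀ x i → S._≈_ i (x i) (S.0# i) → factor x i ≡ k i
  factor-zero x i xᵢ≈0 = trans
    (∑-cong (E.elements i) λ y → ⟦⟧-yes (E._≟_ i (S._·_ i (x i) y) (S.0# i))
      (S.trans i (S.∙-cong i xᵢ≈0 (S.refl i)) (proj₁ (S.zero i) y)))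
    (size-E i)

  -- By `zero-product`, a nonzero element of a chain is annihilated by 0 alone.
  factor-nonzero : ∀ x i → ¬ S._≈_ i (x i) (S.0# i) → factor x i ≡ 1
  factor-nonzero x i xᵢ≉0 = trans
    (∑-cong (E.elements i) λ y →
      ⟦⟧-cong (E._≟_ i (S._·_ i (x i) y) (S.0# i)) (E._≟_ i (S.0# i) y)
        (λ xᵢy≈0 → [ (λ xᵢ≈0 → contradiction xᵢ≈0 xᵢ≉0) , S.sym i ]′ (C.zero-product i xᵢy≈0))
        (λ 0≈y → S.trans i (S.∙-cong i (S.refl i) (S.sym i 0≈y)) (proj₂ (S.zero i) (x i))))
    (E.once i (S.0# i))

  even-annihilators⇒even-degree : ∀ x → 2 ∣ size → 2 ∣ annihilators (proj₁ x) → 2 ∣ degree x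
  even-annihilators⇒even-degree x even-size even-ann = ∣m+n∣m⇒∣n
    (subst (2 ∣_) (trans (sym (degree-formula x)) (ℕ.+-comm (degree x) _)) even-size)
    (∣m∣n⇒∣m+n even-ann ∣-refl)

  even-degree⇒even-annihilators : ∀ x → 2 ∣ size → 2 ∣ degree x → 2 ∣ annihilators (proj₁ x)
  even-degree⇒even-annihilators x even-size even-degree = ∣m+n∣m⇒∣n
    (subst (2 ∣_) (ℕ.+-comm (annihilators (proj₁ x)) 2) (∣m+n∣m⇒∣n
      (subst (2 ∣_) (sym (degree-formula x)) even-size) even-degree))
    ∣-refl

  odd-annihilators⇒even-degree : ∀ x → 2 ∤ size → 2 ∤ annihilators (proj₁ x) → 2 ∣ degree x
  odd-annihilators⇒even-degree x odd-size odd-ann = ∣m+n∣m⇒∣n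
    -- Adding 1 to both odd numbers, the size and the annihilator count, turns the claim into one
    -- about divisibility by 2.
    (subst (2 ∣_) (trans (cong suc (sym (degree-formula x)))
                         (rearrange (degree x) (annihilators (proj₁ x))))
      (odd⇒even-suc size odd-size))
    (∣m∣n⇒∣m+n ∣-refl (odd⇒even-suc _ odd-ann))
    where
    rearrange : ∀ d m → suc (d + (m + 2)) ≡ 2 + suc m + d
    rearrange = solve-∀

  -- Connectedness.

  nonzero-coordinate : ∀ {x} → ¬ x T.≈ T.0# → ∃ λ i → ¬ S._≈_ i (x i) (S.0# i)
  nonzero-coordinate {x} = Fin.¬∀⟶∃¬ n _ λ i → E._≟_ i (x i) (S.0# i)

  indicator : ∀ {i} → Dec P → S.Carrier i
  indicator {i = i} p? = if does p? then S.1# i else S.0# i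

  indicator-yes : ∀ {i} (p? : Dec P) → P → S._≈_ i (indicator p?) (S.1# i)
  indicator-yes {i = i} (yes _) p = S.refl i
  indicator-yes (no ¬p) p = contradiction p ¬p

  indicator-no : ∀ {i} (p? : Dec P) → ¬ P → S._≈_ i (indicator p?) (S.0# i)
  indicator-no (yes p) ¬p = contradiction p ¬p
  indicator-no {i = i} (no _) ¬p = S.refl i

  module _ (i j : Fin n) where
    support? : ∀ t → Dec (t ≡ i ⊎ t ≡ j)
    support? t = t Fin.≟ i ⊎-dec t Fin.≟ j

    pair : T.Carrier
    pair t = indicator (support? t)

    pair-1 : ∀ {t} → t ≡ i ⊎ t ≡ j → S._≈_ t (pair t) (S.1# t)
    pair-1 {t} = indicator-yes (support? t)

    -- n ≥ 3 leaves a coordinate where pair vanishes.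
    pairVertex : Vertex
    pairVertex = pair
      , (λ pair≈0 → 0≉1 i (S.trans i (S.sym i (pair≈0 i)) (pair-1 (inj₁ refl))))
      , (λ pair≈1 → let t , t≢i , t≢j = third 3≤n i j in
          0≉1 t (S.trans t (S.sym t (indicator-no (support? t) [ t≢i , t≢j ]′)) (pair≈1 t)))

  -- Adjacency requires distinct vertices, so equal ones are joined by the empty walk.
  joined : ∀ {x y : Vertex} → ¬ (proj₁ x T.· proj₁ y T.≈ T.0#) → Walk x y
  joined {x} {y} xy≉0 with proj₁ x ≟ proj₁ y
  ... | yes x≈y = nil x≈y
  ... | no x≉y  = cons {y = y} (x≉y , xy≉0) (nil T.refl)

  -- With x nonzero at i and y nonzero at j, the element that is 1 at exactly i and j has a nonzero
  -- product with both.
  connected : Connected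
  connected x@(_ , x≉0 , _) y@(_ , y≉0 , _)
    with i , xᵢ≉0 ← nonzero-coordinate x≉0 | j , yⱼ≉0 ← nonzero-coordinate y≉0 =
    joined {x} {pairVertex i j} (λ xz≈0 → xᵢ≉0 (S.trans i (S.sym i (S.trans i
      (S.∙-cong i (S.refl i) (pair-1 i j (inj₁ refl))) (S.identityʳ i _))) (xz≈0 i)))
    ⁀ joined {pairVertex i j} {y} (λ zy≈0 → yⱼ≉0 (S.trans j (S.sym j (S.trans j
      (S.∙-cong j (pair-1 i j (inj₂ refl)) (S.refl j)) (S.identityˡ j _))) (zy≈0 j)))

  -- The parity criterion.

  i₀ : Fin n
  i₀ = fromℕ< (ℕ.≤-trans (s≤s z≤n) 3≤n)

  vertex : Vertex
  vertex = pairVertex i₀ i₀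

  odd⇒eulerian : (∀ i → 2 ∤ k i) → Eulerian
  odd⇒eulerian odd = even-degree⇒eulerian connected
    (λ x → odd-annihilators⇒even-degree x (Π-odd k odd ∘ subst (2 ∣_) size≡Πk)
      (Π-odd (factor (proj₁ x)) (odd-factor (proj₁ x)) ∘ subst (2 ∣_) (annihilators≡Π (proj₁ x))))
    vertex
    where
    odd-factor : ∀ x i → 2 ∤ factor x i
    odd-factor x i with E._≟_ i (x i) (S.0# i)
    ... | yes xᵢ≈0 = subst (λ m → 2 ∤ m) (sym (factor-zero x i xᵢ≈0)) (odd i)
    ... | no xᵢ≉0  = subst (λ m → 2 ∤ m) (sym (factor-nonzero x i xᵢ≉0))
                       λ 2∣1 → contradiction (∣1⇒≡1 2∣1) λ ()

  two⇒eulerian : (∀ i → k i ≡ 2) → Eulerian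
  two⇒eulerian two = even-degree⇒eulerian connected
    (λ x → even-annihilators⇒even-degree x
      (subst (2 ∣_) (sym size≡Πk) (Π-even k i₀ (even-k i₀))) (even-annihilators x)) vertex
    where
    even-k : ∀ i → 2 ∣ k i
    even-k i = subst (2 ∣_) (sym (two i)) ∣-refl
    even-annihilators : ∀ ((x , _) : Vertex) → 2 ∣ annihilators x
    -- A vertex is not 1 at some coordinate i; in a two-element chain it is then 0 there, so the
    -- factor at i is 2.
    even-annihilators (x , _ , x≉1)
      with i , xᵢ≉1 ← Fin.¬∀⟶∃¬ n _ (λ i → E._≟_ i (x i) (S.1# i)) x≉1 =
      subst (2 ∣_) (sym (annihilators≡Π x)) (Π-even (factor x) i
        (subst (2 ∣_) (sym (factor-zero x i xᵢ≈0)) (even-k i)))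
      where
      xᵢ≈0 : S._≈_ i (x i) (S.0# i)
      xᵢ≈0 = decidable-stable (E._≟_ i (x i) (S.0# i)) λ xᵢ≉0 →
        ℕ.<-irrefl (sym (trans (size-E i) (two i)))
          (C.proper⇒3≤size i (0≉1 i) (E i) (x i , xᵢ≉0 , xᵢ≉1))

  -- A vertex all of whose coordinates are nonzero has degree |S| - 3.
  module _ (m : Fin n) (e : S.Carrier m)
           (e≉0 : ¬ S._≈_ m e (S.0# m)) (e≉1 : ¬ S._≈_ m e (S.1# m)) where

    -- The decision is an argument so that matching on `refl` can give `e` the type required at t.
    place : ∀ {t} → Dec (t ≡ m) → S.Carrier t
    place (yes refl) = e
    place {t} (no _) = S.1# t

    place≉0 : ∀ {t} (t≟m : Dec (t ≡ m)) → ¬ S._≈_ t (place t≟m) (S.0# t)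
    place≉0 (yes refl) = e≉0
    place≉0 {t} (no _) = 0≉1 t ∘ S.sym t

    place≉1 : ∀ {t} (t≟m : Dec (t ≡ m)) → t ≡ m → ¬ S._≈_ t (place t≟m) (S.1# t)
    place≉1 (yes refl) _   = e≉1
    place≉1 (no t≢m)   t≡m = contradiction t≡m t≢m

    dense : T.Carrier
    dense t = place (t Fin.≟ m)

    denseVertex : Vertex
    denseVertex = dense
      , (λ ≈0 → place≉0 (m Fin.≟ m) (≈0 m))
      , (λ ≈1 → place≉1 (m Fin.≟ m) refl (≈1 m))

    annihilators-dense : annihilators dense ≡ 1
    annihilators-dense = trans (annihilators≡Π dense)
      (trans (Π-cong λ i → factor-nonzero dense i (place≉0 (i Fin.≟ m))) (Π-1 n))

  -- One even `k j` makes the size of S even, and then every annihilator count of a vertex is even.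
  -- A third element in any factor would give a vertex with count 1.
  eulerian⇒odd⊎two : Eulerian → (∀ i → 2 ∤ k i) ⊎ (∀ i → k i ≡ 2)
  eulerian⇒odd⊎two eulerian with Fin.all? (λ i → ¬? (2 ∣? k i))
  ... | yes odd = inj₁ odd
  ... | no ¬odd with j , ¬odd-kⱼ ← Fin.¬∀⟶∃¬ n _ (λ i → ¬? (2 ∣? k i)) ¬odd =
    inj₂ λ m → decidable-stable (k m ℕ.≟ 2) λ kₘ≢2 →
      let e , e≉0 , e≉1 = C.size≢2⇒proper m (0≉1 m) (E m) (kₘ≢2 ∘ trans (sym (size-E m)))
          x = denseVertex m e e≉0 e≉1
          even-size = subst (2 ∣_) (sym size≡Πk)
            (Π-even k j (decidable-stable (2 ∣? k j) ¬odd-kⱼ))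
      in contradiction
        (∣1⇒≡1 (subst (2 ∣_) (annihilators-dense m e e≉0 e≉1)
          (even-degree⇒even-annihilators x even-size (eulerian⇒even-degree eulerian x))))
        λ ()

theorem2p18 : ∀ {c ℓ} (n : ℕ) → 3 ≤ n →
    (S : Fin n → BoundedSemilattice c ℓ) →
    (∀ i → ¬ (_≈_ (S i) (0# (S i)) (1# (S i)))) →
    (∀ i → IsFinite (setoid (S i))) →
    (∀ i → IsChain (S i)) →
    SimpleGraph.Eulerian (G (∏ S)) ⇔
    ((∀ i → HasEvenLength (poset (S i))) ⊎ (∀ i → HasSize (setoid (S i)) 2))
theorem2p18 n 3≤n S 0≉1 finite chain = mk⇔
  (λ eulerian → Sum.map
    (λ odd i → Equivalence.from (length⇔ i) (odd i))
    (λ two i → subst (HasSize (setoid (S i))) (two i) (proj₂ (finite i)))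
    (P.eulerian⇒odd⊎two finite eulerian))
  [ (λ even → P.odd⇒eulerian finite λ i → Equivalence.to (length⇔ i) (even i))
  -- The bijections of (b) themselves serve as the finiteness proof, so every `k i` is 2 by
  -- computation.
  , (λ two → P.two⇒eulerian (λ i → 2 , two i) λ _ → refl)
  ]′
  where
  module P finite = ProductOfChains 3≤n S 0≉1 finite chain
  length⇔ : ∀ i → HasEvenLength (poset (S i)) ⇔ 2 ∤ proj₁ (finite i)
  length⇔ i = FiniteChains.even-length⇔odd-size (S i) (chain i) (proj₂ (finite i))
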